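{- A digraph $H$ is a hero in $(\mathcal{A}\cup\mathcal{T})^*$ if and only if $H$ is a hero in tournaments. In particular, a digraph $H$ is a hero in the class of oriented graphs with no induced subdigraph isomorphic to $\vec{P}_3$ if and only if $H$ is a hero in tournaments.
   Context: The dichromatic number $\vec{\chi}(D)$ of a digraph is the least number of parts in a partition of $V(D)$ into sets inducing acyclic subdigraphs. Given a class $\mathcal{C}$ of digraphs, a digraph $H$ is a hero in $\mathcal{C}$ if there exists a constant $c$ such that every digraph in $\mathcal{C}$ having no induced subdigraph isomorphic to $H$ has dichromatic number at most $c$; heroes in tournaments are heroes in the class of tournaments. Substitution: given digraphs $G_1$ and $H_1$ with disjoint vertex sets and $u\in V(G_1)$, the digraph obtained by substituting $H_1$ for $u$ has vertex set $(V(G_1)\setminus\{u\})\cup V(H_1)$, induces $G_1-u$ on $V(G_1)\setminus\{u\}$ and $H_1$ on $V(H_1)$, and each $v\in V(G_1)\setminus\{u\}$ sees (resp. is seen by, resp. is non-adjacent to) every vertex of $H_1$ exactly when $v$ sees (resp. is seen by, resp. is non-adjacent to) $u$ in $G_1$. $\mathcal{T}$ is the class of tournaments, $\mathcal{A}$ the class of acyclic digraphs, and $(\mathcal{A}\cup\mathcal{T})^*$ is the class of digraphs obtained from a single vertex by repeatedly substituting vertices by digraphs in $\mathcal{A}\cup\mathcal{T}$. An oriented graph is a digraph with no pair of opposite arcs. $\vec{P}_3$ is the directed path on three vertices $x_1\to x_2\to x_3$ (with no arc between $x_1$ and $x_3$). -}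

module Defs where

open import Data.Nat using (ℕ; zero; suc; _+_)
open import Data.Fin using (Fin; zero; suc; punchIn; splitAt; inject₁; fromℕ)
open import Data.Bool using (Bool; true; false; not)
open import Data.Sum using (_⊎_; inj₁; inj₂)
open import Data.Product using (Σ; _×_; _,_; ∃)
open import Relation.Binary.PropositionalEquality using (_≡_; _≢_; refl)
open import Relation.Nullary using (¬_)
open import Data.Unit using (⊤)
open import Function.Definitions using (Injective)

-- A (finite, loopless) digraph on vertex set Fin size; arc i j = true means i → j.
-- Opposite arcs (digons) are allowed.
record Digraph : Set where
  constructor mkDigraph
  field
    size     : ℕ
    arc      : Fin size → Fin size → Bool
    loopless : ∀ i → arc i i ≡ false
open Digraph public

Embeds : Digraph → Digraph → Set
Embeds H D = Σ (Fin (size H) → Fin (size D)) λ f →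
  Injective _≡_ _≡_ f × (∀ i j → arc H i j ≡ arc D (f i) (f j))

record Cycle (D : Digraph) (P : Fin (size D) → Set) : Set where
  field
    len    : ℕ
    g      : Fin (suc len) → Fin (size D)
    inj    : Injective _≡_ _≡_ g
    step   : ∀ (i : Fin len) → arc D (g (inject₁ i)) (g (suc i)) ≡ true
    close  : arc D (g (fromℕ len)) (g zero) ≡ true
    inside : ∀ i → P (g i)

Acyclic : Digraph → Set
Acyclic D = ¬ Cycle D (λ _ → ⊤)

DichromaticAtMost : Digraph → ℕ → Set
DichromaticAtMost D k = Σ (Fin (size D) → Fin k) λ c →
  ∀ (col : Fin k) → ¬ Cycle D (λ v → c v ≡ col)

Hero : (Digraph → Set) → Digraph → Set
Hero C H = ∃ λ (c : ℕ) → ∀ (D : Digraph) → C D → ¬ Embeds H D → DichromaticAtMost D c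

Tournament : Digraph → Set
Tournament D = ∀ i j → i ≢ j → arc D i j ≡ not (arc D j i)

Oriented : Digraph → Set
Oriented D = ∀ i j → arc D i j ≡ true → arc D j i ≡ false

P3arc : Fin 3 → Fin 3 → Bool
P3arc zero (suc zero) = true
P3arc (suc zero) (suc (suc zero)) = true
P3arc _ _ = false

P3-loopless : ∀ i → P3arc i i ≡ false
P3-loopless zero = refl
P3-loopless (suc zero) = refl
P3-loopless (suc (suc zero)) = refl

P3 : Digraph
P3 = mkDigraph 3 P3arc P3-loopless

OrientedP3Free : Digraph → Set
OrientedP3Free D = Oriented D × ¬ Embeds P3 D

SingleVertex : Digraph
SingleVertex = mkDigraph 1 (λ _ _ → false) (λ _ → refl)

-- Substitution of H1 (nonempty) for the vertex u of G.
-- New vertex set: Fin (n + m) ≅ (V(G) ∖ {u}) ⊎ V(H1), where the remaining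
-- vertices of G are enumerated via punchIn u.
module _ {n m : ℕ} (G : Fin (suc n) → Fin (suc n) → Bool) (u : Fin (suc n))
         (H : Fin m → Fin m → Bool) where
  substArc′ : Fin n ⊎ Fin m → Fin n ⊎ Fin m → Bool
  substArc′ (inj₁ a) (inj₁ b) = G (punchIn u a) (punchIn u b)
  substArc′ (inj₁ a) (inj₂ b) = G (punchIn u a) u
  substArc′ (inj₂ a) (inj₁ b) = G u (punchIn u b)
  substArc′ (inj₂ a) (inj₂ b) = H a b

  substArc′-loopless : (∀ i → G i i ≡ false) → (∀ i → H i i ≡ false) →
                       ∀ s → substArc′ s s ≡ false
  substArc′-loopless lG lH (inj₁ a) = lG (punchIn u a)
  substArc′-loopless lG lH (inj₂ a) = lH a

substitute : (G : Digraph) → Fin (size G) → (H : Digraph) → Digraph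
substitute (mkDigraph zero _ _) () H
substitute (mkDigraph (suc n) G lG) u (mkDigraph m H lH) =
  mkDigraph (n + m)
    (λ x y → substArc′ G u H (splitAt n x) (splitAt n y))
    (λ x → substArc′-loopless G u H lG lH (splitAt n x))

Nonempty : Digraph → Set
Nonempty H = Σ ℕ λ k → size H ≡ suc k

data ATStar : Digraph → Set where
  single : ATStar SingleVertex
  subst  : ∀ G (u : Fin (size G)) H → ATStar G →
           (Acyclic H ⊎ Tournament H) → Nonempty H →
           ATStar (substitute G u H)

{-# OPTIONS --safe #-}
module Submission where

-- Say that S′ dominates S if every k sufficient to colour S′ suffices for S, and call a vertex
-- set irreducible if no deletion of one vertex leaves a set dominating it. Every digraph is
-- dominated by an irreducible subset, so it is enough that irreducible sets are tournaments:
-- then an H-free digraph needs no more colours than some H-free tournament.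
--
-- Irreducible sets are strong, and a homogeneous subset (module) of an irreducible set is
-- irreducible, as only the number of colours that a module uses matters to the rest.
-- In (𝒜 ∪ 𝒯)*, the modules arising from acyclic digraphs are irreducible, hence strong, so they
-- do not spread over more than one vertex of the acyclic digraph. In a quasi-transitive oriented
-- graph, a component of the complement graph is a module, hence strong; but a strong
-- quasi-transitive digraph with connected complement has a single vertex.

open import Defs
open import Data.Product using (_×_)
open import Function.Bundles using (_⇔_)

open import Data.Bool using (Bool; true; false; not)
import Data.Bool.Properties as Bool
open import Data.Empty using (⊥-elim)
open import Data.Fin
  using (Fin; zero; suc; toℕ; fromℕ; fromℕ<; inject₁; join; punchIn; splitAt; finToFun; funToFin)
import Data.Fin.Properties as Fin
open import Data.Fin.Subset using (Subset; _⊂_; _⊃_; _∈_; _∉_; _∪_; _-_; ⁅_⁆) renaming (⊤ to full)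
open import Data.Fin.Subset.Induction using (⊂-wellFounded; ⊃-wellFounded; Acc; acc)
open import Data.Fin.Subset.Properties
  using (_∈?_; ∈⊤; x∈⁅x⁆; x∈⁅y⁆⇒x≡y; x∈p∪q⁺; x∈p∪q⁻; x∈p∧x≢y⇒x∈p-y; x∈p⇒p-x⊂p)
open import Data.List using (List; map; filter; allFin; deduplicate; length; lookup)
import Data.List.Membership.Propositional as List
open import Data.List.Membership.Propositional.Properties
  using (∈-map⁺; ∈-map⁻; ∈-filter⁺; ∈-filter⁻; ∈-allFin; ∈-deduplicate⁺; ∈-deduplicate⁻; ∈-lookup)
import Data.List.Relation.Unary.All as All
open import Data.List.Relation.Unary.AllPairs using (_∷_)
open import Data.List.Relation.Unary.Any using (index)
open import Data.List.Relation.Unary.Any.Properties using (lookup-index)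
open import Data.List.Relation.Unary.Unique.Propositional using (Unique)
import Data.List.Relation.Unary.Unique.Propositional.Properties as Unique
open import Data.List.Relation.Unary.Unique.DecPropositional.Properties using (deduplicate-!)
open import Data.Nat using (ℕ; zero; suc; _+_; _≤_; _<_)
import Data.Nat.Properties as ℕ
open import Data.Product using (∃; ∃-syntax; _,_; proj₁; proj₂)
open import Data.Sum as Sum using (_⊎_; inj₁; inj₂; [_,_]′; swap)
import Data.Sum.Properties as Sum
open import Data.Unit using (⊤; tt)
open import Effect.Monad using (RawMonad)
open import Function using (_∘_; id)
open import Function.Bundles using (mk⇔)
open import Function.Definitions using (Injective)
open import Level using (0ℓ)
open import Relation.Binary using (Rel)
open import Relation.Binary.Construct.Closure.ReflexiveTransitive using (Star; ε; _◅_; _◅◅_; gmap)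
open import Relation.Binary.PropositionalEquality
  using (_≡_; _≢_; refl; sym; trans; cong; cong₂; subst₂; _≗_)
  renaming (subst to transport)
open import Relation.Nullary using (¬_; Dec; yes; no; contradiction)
open import Relation.Nullary.Decidable
  using (¬¬-excluded-middle; decidable-stable; map′; _×-dec_; _⊎-dec_; _→-dec_; ¬?; toSum)
open import Relation.Nullary.Negation using (¬¬-Monad)
open import Relation.Unary using (Pred; Decidable; _⊆_)

-- Double negation over finite types, and walks

private variable n : ℕ

-- Double negation commutes with finite conjunctions, so classical choices can be made at all
-- vertices at once.
¬¬-∀ : {P : Pred (Fin n) 0ℓ} → (∀ i → ¬ ¬ P i) → ¬ ¬ (∀ i → P i)
¬¬-∀ = Fin.sequence (RawMonad.rawApplicative ¬¬-Monad)

¬¬-decidable : (P : Pred (Fin n) 0ℓ) → ¬ ¬ Decidable P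
¬¬-decidable P = ¬¬-∀ (λ _ → ¬¬-excluded-middle)

module _ {A : Set} where

  lookup-injective : {xs : List A} → Unique xs → ∀ i j → lookup xs i ≡ lookup xs j → i ≡ j
  lookup-injective (_ ∷ _)    zero    zero    _  = refl
  lookup-injective (x∉ ∷ _)   zero    (suc j) eq = contradiction eq (All.lookup x∉ (∈-lookup j))
  lookup-injective (x∉ ∷ _)   (suc i) zero    eq = contradiction (sym eq) (All.lookup x∉ (∈-lookup i))
  lookup-injective (_ ∷ xs!)  (suc i) (suc j) eq = cong suc (lookup-injective xs! i j eq)

  -- Forbids closed walks of positive length: an arc followed by a walk back.
  NoCycle : Rel A 0ℓ → Set
  NoCycle R = ∀ {u v} → R u v → ¬ Star R v u

  forward : {R R′ : Rel A 0ℓ} {P : Pred A 0ℓ} →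
            (∀ {u v} → P u → R u v → P v × R′ u v) →
            ∀ {u v} → P u → Star R u v → Star R′ u v
  forward next p ε        = ε
  forward next p (r ◅ rs) = let q , r′ = next p r in r′ ◅ forward next q rs

  backward : {R R′ : Rel A 0ℓ} {P : Pred A 0ℓ} →
             (∀ {u v} → R u v → P v → P u × R′ u v) →
             ∀ {u v} → Star R u v → P v → P u × Star R′ u v
  backward prev ε        p = p , ε
  backward prev (r ◅ rs) p =
    let q , rs′ = backward prev rs p ; q′ , r′ = prev r q in q′ , r′ ◅ rs′

  NoCycle-⊆ : {R R′ : Rel A 0ℓ} → (∀ {u v} → R u v → R′ u v) → NoCycle R′ → NoCycle R
  NoCycle-⊆ f acyc r rs = acyc (f r) (gmap id f rs)

-- Simple cycles from closed walks, and conversely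

module _ (D : Digraph) where

  V : Set
  V = Fin (size D)

  infix 4 _⟶_
  _⟶_ : Rel V 0ℓ
  u ⟶ v = arc D u v ≡ true

  Step : Pred V 0ℓ → Rel V 0ℓ
  Step S u v = u ⟶ v × S u × S v

  Mono : Pred V 0ℓ → (V → ℕ) → Rel V 0ℓ
  Mono S c u v = Step S u v × c u ≡ c v

  walk-ends : ∀ {S : Pred V 0ℓ} len (g : Fin (suc len) → V) →
              (∀ i → g (inject₁ i) ⟶ g (suc i)) → (∀ i → S (g i)) →
              Star (Step S) (g zero) (g (fromℕ len))
  walk-ends zero      g step ins = ε
  walk-ends (suc len) g step ins =
    (step zero , ins zero , ins (suc zero)) ◅ walk-ends len (g ∘ suc) (step ∘ suc) (ins ∘ suc)

  cycle⇒closed-walk : ∀ {S} → Cycle D S → ¬ NoCycle (Step S)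
  cycle⇒closed-walk cyc acyc =
    acyc (close , inside (fromℕ len) , inside zero) (walk-ends len g step inside)
    where open Cycle cyc

  record SimplePath (S : Pred V 0ℓ) (u v : V) : Set where
    field
      len    : ℕ
      g      : Fin (suc len) → V
      inj    : Injective _≡_ _≡_ g
      step   : ∀ (i : Fin len) → g (inject₁ i) ⟶ g (suc i)
      inside : ∀ i → S (g i)
      first  : g zero ≡ u
      last   : g (fromℕ len) ≡ v

  suffix : ∀ {S v} len (g : Fin (suc len) → V) → Injective _≡_ _≡_ g →
           (∀ (i : Fin len) → g (inject₁ i) ⟶ g (suc i)) → (∀ i → S (g i)) →
           g (fromℕ len) ≡ v → ∀ i → SimplePath S (g i) v
  suffix len g inj step ins last zero = record
    { len = len ; g = g ; inj = inj ; step = step ; inside = ins ; first = refl ; last = last }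
  suffix (suc len) g inj step ins last (suc i) =
    suffix len (g ∘ suc) (Fin.suc-injective ∘ inj) (step ∘ suc) (ins ∘ suc) last i

  -- If `u` already lies on the path, the part before it is discarded instead, which keeps the path
  -- simple.
  prepend : ∀ {S u w v} → Step S u w → SimplePath S w v → SimplePath S u v
  prepend {S} {u} {w} {v} (a , su , sw) p with Fin.any? (λ i → SimplePath.g p i Fin.≟ u)
  ... | yes (i , refl) = suffix len g inj step inside last i
    where open SimplePath p
  ... | no u∉p = record
    { len = suc len ; g = g′ ; inj = inj′ ; step = step′ ; inside = inside′
    ; first = refl ; last = last }
    where
    open SimplePath p
    g′ : Fin (suc (suc len)) → V
    g′ zero    = u
    g′ (suc i) = g i
    inj′ : Injective _≡_ _≡_ g′
    inj′ {zero}  {zero}  _ = refl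
    inj′ {zero}  {suc j} e = contradiction (j , sym e) u∉p
    inj′ {suc i} {zero}  e = contradiction (i , e) u∉p
    inj′ {suc i} {suc j} e = cong suc (inj e)
    step′ : ∀ i → g′ (inject₁ i) ⟶ g′ (suc i)
    step′ zero    = transport (u ⟶_) (sym first) a
    step′ (suc i) = step i
    inside′ : ∀ i → S (g′ i)
    inside′ zero    = su
    inside′ (suc i) = inside i

  simplePath : ∀ {S u v} → S u → Star (Step S) u v → SimplePath S u v
  simplePath {u = u} su ε = record
    { len = 0 ; g = λ _ → u ; inj = λ { {zero} {zero} _ → refl } ; step = λ ()
    ; inside = λ _ → su ; first = refl ; last = refl }
  simplePath su (r@(_ , _ , sw) ◅ rs) = prepend r (simplePath sw rs)

  -- A closed walk may repeat vertices: what follows its first arc is shortened to a simple path,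
  -- which that arc closes to a cycle.
  noCycle : ∀ {S} → ¬ Cycle D S → NoCycle (Step S)
  noCycle ¬cyc (a , su , sv) rs = ¬cyc record
    { len = len ; g = g ; inj = inj ; step = step
    ; close = subst₂ _⟶_ (sym last) (sym first) a ; inside = inside }
    where open SimplePath (simplePath sv rs)

-- Irreducible vertex sets

  -- Colours are natural numbers bounded on `S` alone, so one colouring serves subsets and larger
  -- bounds without conversion.
  Colourable : Pred V 0ℓ → ℕ → Set
  Colourable S k = ∃[ c ] (∀ v → S v → c v < k) × NoCycle (Mono S c)

  -- The double negation makes excluded middle available; it is removed at the very end, since
  -- being k-colourable is decidable.
  Dominates : Pred V 0ℓ → Pred V 0ℓ → Set
  Dominates S′ S = ∀ k → Colourable S′ k → ¬ ¬ Colourable S k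

  infixl 6 _∖_
  _∖_ : Pred V 0ℓ → V → Pred V 0ℓ
  (S ∖ v) x = S x × x ≢ v

  Irreducible : Pred V 0ℓ → Set
  Irreducible S = ∀ v → S v → ¬ Dominates (S ∖ v) S

  TournamentOn : Pred V 0ℓ → Set
  TournamentOn S = ∀ u v → S u → S v → u ≢ v → arc D u v ≡ not (arc D v u)

  Homogeneous : Pred V 0ℓ → Pred V 0ℓ → Set
  Homogeneous S M = ∀ {z m m′} → S z → ¬ M z → M m → M m′ →
                    arc D z m ≡ arc D z m′ × arc D m z ≡ arc D m′ z

  Mono-⊆ : ∀ {S S′ c u v} → S ⊆ S′ → Mono S c u v → Mono S′ c u v
  Mono-⊆ S⊆S′ ((a , su , sv) , e) = (a , S⊆S′ su , S⊆S′ sv) , e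

  colourable-⊆ : ∀ {S S′ k} → S ⊆ S′ → Colourable S′ k → Colourable S k
  colourable-⊆ S⊆S′ (c , c< , acyc) =
    c , (λ v s → c< v (S⊆S′ s)) , NoCycle-⊆ (Mono-⊆ S⊆S′) acyc

  -- Colours used on a set

  module _ {P : Pred V 0ℓ} (P? : Decidable P) (c : V → ℕ) where

    palette : List ℕ
    palette = deduplicate ℕ._≟_ (map c (filter P? (allFin (size D))))

    palette-unique : Unique palette
    palette-unique = deduplicate-! ℕ._≟_ _

    ∈-palette : ∀ {w} → P w → c w List.∈ palette
    ∈-palette {w} p = ∈-deduplicate⁺ ℕ._≟_ (∈-map⁺ c (∈-filter⁺ P? (∈-allFin w) p))

    palette-used : ∀ i → ∃[ w ] P w × c w ≡ lookup palette i
    palette-used i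
      with w , w∈ , eq ← ∈-map⁻ c (∈-deduplicate⁻ ℕ._≟_ _ (∈-lookup {xs = palette} i))
      = w , proj₂ (∈-filter⁻ P? {xs = allFin (size D)} w∈) , sym eq

    relabel : V → ℕ
    relabel w with P? w
    ... | yes p = toℕ (index (∈-palette p))
    ... | no _  = 0

    relabel-index : ∀ {w} → P w → ∃[ i ] relabel w ≡ toℕ i × lookup palette i ≡ c w
    relabel-index {w} p with P? w
    ... | yes q = _ , refl , sym (lookup-index (∈-palette q))
    ... | no ¬p = contradiction p ¬p

    -- Numbering colours by their place in the palette merges none of those used on `P`, so it
    -- creates no monochromatic arc.
    palette-colourable : NoCycle (Mono P c) → Colourable P (length palette)
    palette-colourable acyc = relabel , bound , NoCycle-⊆ unlabel acyc
      where
      bound : ∀ w → P w → relabel w < length palette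
      bound w p = let i , eq , _ = relabel-index p in
        transport (_< length palette) (sym eq) (Fin.toℕ<n i)
      unlabel : ∀ {u v} → Mono P relabel u v → Mono P c u v
      unlabel (s@(_ , pu , pv) , e) =
        let i , ei , li = relabel-index pu ; j , ej , lj = relabel-index pv
            i≡j = Fin.toℕ-injective (trans (sym ei) (trans e ej))
        in s , trans (sym li) (trans (cong (lookup palette) i≡j) lj)

  -- A monochromatic closed walk leaving M is moved off v: whenever it is in M, replace its
  -- position by any vertex of M ∖ v with the same colour.
  module Glue {S M : Pred V 0ℓ} (M? : Decidable M) (M⊆S : M ⊆ S) (hom : Homogeneous S M)
              {v : V} (vM : M v) {c d e : V → ℕ}
              (c-acyclic : NoCycle (Mono (S ∖ v) c)) (d-acyclic : NoCycle (Mono M d))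
              (e-on-M : ∀ {w w′} → M w → M w′ → e w ≡ e w′ → d w ≡ d w′)
              (e-off-M : ∀ {w} → ¬ M w → e w ≡ c w)
              (colour-reused : ∀ {w} → M w → ∃[ p ] (M ∖ v) p × c p ≡ e w) where

    data Stands : V → V → Set where
      off : ∀ {w} → S w → ¬ M w → Stands w w
      on  : ∀ {w p} → M w → (M ∖ v) p → c p ≡ e w → Stands w p

    stands-colour : ∀ {w p} → Stands w p → c p ≡ e w
    stands-colour (off _ ¬m) = sym (e-off-M ¬m)
    stands-colour (on _ _ eq) = eq

    stands-in : ∀ {w p} → Stands w p → (S ∖ v) p
    stands-in (off s ¬m) = s , λ { refl → ¬m vM }
    stands-in (on _ (mp , p≢v) _) = M⊆S mp , p≢v

    stand : ∀ {w} → S w → ∃[ p ] Stands w p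
    stand {w} s with M? w
    ... | yes m = let p , q , eq = colour-reused m in p , on m q eq
    ... | no ¬m = w , off s ¬m

    move : ∀ {w w′ p p′} → Stands w p → Stands w′ p′ → ¬ (M w × M w′) →
           Mono S e w w′ → Mono (S ∖ v) c p p′
    move x y not-both ((a , _ , _) , eq) =
      (arc-moved x y , stands-in x , stands-in y) ,
      trans (stands-colour x) (trans eq (sym (stands-colour y)))
      where
      arc-moved : ∀ {p p′} → Stands _ p → Stands _ p′ → p ⟶ p′
      arc-moved (off _ _)           (off _ _)           = a
      arc-moved (off s ¬m)          (on m′ (mp , _) _)  = trans (proj₁ (hom s ¬m mp m′)) a
      arc-moved (on m (mp , _) _)   (off s ¬m)          = trans (proj₂ (hom s ¬m mp m)) a
      arc-moved (on m _ _)          (on m′ _ _)         = contradiction (m , m′) not-both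

    advance : ∀ {w w′ p} → Stands w p → Mono S e w w′ →
              ∃[ p′ ] Stands w′ p′ × Star (Mono (S ∖ v) c) p p′
    advance {w} {w′} x r@((_ , _ , sw′) , eq) with M? w ×-dec M? w′ | x
    ... | no not-both | _ =
      let p′ , y = stand sw′ in p′ , y , move x y not-both r ◅ ε
    -- Within `M` the colour is unchanged, so one stand-in serves both ends and does not move.
    ... | yes (_ , m′) | on _ q eq′ = _ , on m′ q (trans eq′ eq) , ε
    ... | yes (m , _)  | off _ ¬m   = contradiction m ¬m

    walk : ∀ {w w′ p} → Stands w p → Star (Mono S e) w w′ →
           ∃[ p′ ] Stands w′ p′ × Star (Mono (S ∖ v) c) p p′
    walk x ε        = _ , x , ε
    walk x (r ◅ rs) = let _ , y , s = advance x r ; _ , z , t = walk y rs in _ , z , s ◅◅ t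

    -- A vertex off `M` stands for itself, so the moved walk is closed. It is not empty, since its
    -- first arc, leaving `u`, is really moved.
    no-cycle-off-M : ∀ {u x} → ¬ M u → Mono S e u x → ¬ Star (Mono S e) x u
    no-cycle-off-M ¬mu r@((_ , su , sx) , _) rs with stand sx
    ... | _ , y with walk y rs
    ... | _ , on m _ _ , _ = ¬mu m
    ... | _ , off _ _  , t = c-acyclic (move (off su ¬mu) y (¬mu ∘ proj₁) r) t

    -- A closed walk with a vertex off `M` could be started there, against `no-cycle-off-M`.
    closed-in-M : ∀ {u w} → M u → Star (Mono S e) u w → Star (Mono S e) w u → M w
    closed-in-M {w = w} mu there back with M? w | back
    ... | yes m | _      = m
    ... | no ¬m | ε      = mu
    ... | no ¬m | r ◅ rs = contradiction (rs ◅◅ there) (no-cycle-off-M ¬m r)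

    restrict : ∀ {w w′} → M w → M w′ → Mono S e w w′ → Mono M d w w′
    restrict m m′ ((a , _ , _) , eq) = (a , m , m′) , e-on-M m m′ eq

    walk-in-M : ∀ {u w} → M u → Star (Mono S e) u w → Star (Mono S e) w u → Star (Mono M d) w u
    walk-in-M mu there ε        = ε
    walk-in-M mu there (r ◅ rs) =
      restrict (closed-in-M mu there (r ◅ rs)) (closed-in-M mu there′ rs) r ◅ walk-in-M mu there′ rs
      where there′ = there ◅◅ r ◅ ε

    glued-acyclic : NoCycle (Mono S e)
    glued-acyclic {u} {x} r rs with M? u
    ... | no ¬mu = no-cycle-off-M ¬mu r rs
    ... | yes mu = d-acyclic (restrict mu (closed-in-M mu (r ◅ ε) rs) r) (walk-in-M mu (r ◅ ε) rs)

  module Repaint {M : Pred V 0ℓ} (M? : Decidable M) (c : V → ℕ) (L : List ℕ) {d : V → ℕ}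
                 (d<L : ∀ w → M w → d w < length L) where

    -- The colours of `d` serve as positions in `L`. With `L` the colours of `c` on `M ∖ v`,
    -- repainting `M` brings in no new colour.
    repaint : V → ℕ
    repaint w with M? w
    ... | yes m = lookup L (fromℕ< (d<L w m))
    ... | no _  = c w

    repaint-on : ∀ {w} (m : M w) → repaint w ≡ lookup L (fromℕ< (d<L w m))
    repaint-on {w} m with M? w
    ... | yes _ = refl
    ... | no ¬m = contradiction m ¬m

    repaint-off : ∀ {w} → ¬ M w → repaint w ≡ c w
    repaint-off {w} ¬m with M? w
    ... | yes m = contradiction m ¬m
    ... | no _  = refl

    repaint-injective : Unique L → ∀ {w w′} → M w → M w′ → repaint w ≡ repaint w′ → d w ≡ d w′
    repaint-injective L! {w} {w′} m m′ eq = Fin.fromℕ<-injective (d w) (d w′) (d<L w m) (d<L w′ m′)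
      (lookup-injective L! _ _ (trans (sym (repaint-on m)) (trans eq (repaint-on m′))))

  -- Suppose `M ∖ v` dominates `M`. As many colours as a colouring `c` of `S ∖ v` uses on `M ∖ v`
  -- are then enough for `M`. Painting `M` with these very colours and keeping `c` elsewhere colours
  -- `S`, so `S ∖ v` dominates `S`.
  irreducible-homogeneous : ∀ {S M} → Irreducible S → M ⊆ S → Homogeneous S M → Irreducible M
  irreducible-homogeneous {S} {M} irr M⊆S hom v vM dom =
    irr v (M⊆S vM) λ k (c , c<k , c-acyclic) ¬col → ¬¬-decidable M λ M? →
    let P? : Decidable (M ∖ v)
        P? w = M? w ×-dec ¬? (w Fin.≟ v)
        L = palette P? c
    in dom (length L)
         (palette-colourable P? c (NoCycle-⊆ (Mono-⊆ λ (m , ≢v) → M⊆S m , ≢v) c-acyclic))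
         λ (d , d<L , d-acyclic) →
    let open Repaint M? c L d<L
        reused : ∀ {w} → M w → ∃[ p ] (M ∖ v) p × c p ≡ repaint w
        reused m = let p , q , eq = palette-used P? c _ in p , q , trans eq (sym (repaint-on m))
        bound : ∀ w → S w → repaint w < k
        bound w s = [ (λ m → let p , (mp , p≢v) , eq = reused m in
                             transport (_< k) eq (c<k p (M⊆S mp , p≢v)))
                    , (λ ¬m → transport (_< k) (sym (repaint-off ¬m))
                                (c<k w (s , λ { refl → ¬m vM }))) ]′ (toSum (M? w))
    in ¬col (repaint , bound , Glue.glued-acyclic M? M⊆S hom vM c-acyclic d-acyclic
         (repaint-injective (palette-unique P? c)) repaint-off reused)

  -- Strong connectivity of irreducible sets

  colourable-≤ : ∀ {S k k′} → k ≤ k′ → Colourable S k → Colourable S k′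
  colourable-≤ k≤k′ (c , c<k , acyc) = c , (λ v s → ℕ.<-≤-trans (c<k v s) k≤k′) , acyc

  -- No arc of `S` leaves `A`, so a closed walk lies on one side: started in `A` it stays there, and
  -- read backwards from a vertex outside it never enters `A`. Both sides can thus use the same
  -- colours.
  colourable-split : ∀ {S A : Pred V 0ℓ} {k} → Decidable A →
                     (∀ {u v} → A u → Step S u v → A v) →
                     Colourable (λ w → S w × A w) k → Colourable (λ w → S w × ¬ A w) k →
                     Colourable S k
  colourable-split {S} {A} {k} A? closed
    (c , c<k , c-acyclic) (d , d<k , d-acyclic) = e , bound , acyclic
    where
    e : V → ℕ
    e w with A? w
    ... | yes _ = c w
    ... | no _  = d w

    e-on : ∀ {w} → A w → e w ≡ c w
    e-on {w} a with A? w
    ... | yes _ = refl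
    ... | no ¬a = contradiction a ¬a

    e-off : ∀ {w} → ¬ A w → e w ≡ d w
    e-off {w} ¬a with A? w
    ... | yes a = contradiction a ¬a
    ... | no _  = refl

    bound : ∀ w → S w → e w < k
    bound w s with A? w
    ... | yes a = c<k w (s , a)
    ... | no ¬a = d<k w (s , ¬a)

    onward : ∀ {u v} → A u → Mono S e u v → A v × Mono (λ w → S w × A w) c u v
    onward au (r@(a , su , sv) , eq) =
      let av = closed au r in
      av , (a , (su , au) , (sv , av)) , trans (sym (e-on au)) (trans eq (e-on av))

    back : ∀ {u v} → Mono S e u v → ¬ A v → ¬ A u × Mono (λ w → S w × ¬ A w) d u v
    back (r@(a , su , sv) , eq) ¬av =
      let ¬au = λ au → ¬av (closed au r) in
      ¬au , (a , (su , ¬au) , (sv , ¬av)) , trans (sym (e-off ¬au)) (trans eq (e-off ¬av))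

    acyclic : NoCycle (Mono S e)
    acyclic {u} r rs =
      [ (λ au → let av , r′ = onward au r in c-acyclic r′ (forward onward av rs))
      , (λ ¬au → let ¬av , rs′ = backward back rs ¬au in d-acyclic (proj₂ (back r ¬av)) rs′)
      ]′ (toSum (A? u))

  Reach : Pred V 0ℓ → Rel V 0ℓ
  Reach S = Star (Step S)

  Strong : Pred V 0ℓ → Set
  Strong S = ∀ {u v} → S u → S v → Reach S u v

  -- Otherwise no arc leaves the set reachable from x, so S needs no more colours than
  -- one of S ∖ x and S ∖ y.
  irreducible-reach : ∀ {S x y} → Irreducible S → S x → S y → ¬ ¬ Reach S x y
  irreducible-reach {S} {x} {y} irr sx sy ¬xy =
    irr y sy λ k₁ col₁ ¬col₁ → irr x sx λ k₂ col₂ ¬col₂ → ¬¬-decidable (Reach S x) λ A? →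
    let glue : ∀ {k} → Colourable (S ∖ y) k → Colourable (S ∖ x) k → Colourable S k
        glue p q = colourable-split A? (λ a r → a ◅◅ r ◅ ε)
          (colourable-⊆ (λ { (s , a) → s , λ { refl → ¬xy a } }) p)
          (colourable-⊆ (λ { (s , ¬a) → s , λ { refl → ¬a ε } }) q)
    in [ (λ k₁≤k₂ → ¬col₂ (glue (colourable-≤ k₁≤k₂ col₁) col₂))
       , (λ k₂≤k₁ → ¬col₁ (glue col₁ (colourable-≤ k₂≤k₁ col₂))) ]′ (ℕ.≤-total k₁ k₂)

  irreducible-strong : ∀ {S} → Irreducible S → ¬ ¬ Strong S
  irreducible-strong {S} irr ¬strong =
    ¬¬-decidable S λ S? →
    ¬¬-∀ {P = λ u → ∀ v → S u → S v → Reach S u v}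
      (λ u → ¬¬-∀ λ v → reach u v (S? u) (S? v))
      (λ f → ¬strong (f _ _))
    where
    reach : ∀ u v → Dec (S u) → Dec (S v) → ¬ ¬ (S u → S v → Reach S u v)
    reach u v (yes su) (yes sv) ¬r = irreducible-reach irr su sv (λ r → ¬r λ _ _ → r)
    reach u v (yes _)  (no ¬sv) ¬r = ¬r (λ _ sv → contradiction sv ¬sv)
    reach u v (no ¬su) _        ¬r = ¬r (λ su → contradiction su ¬su)

  -- Vertices are deleted as long as the rest still dominates; domination is transitive and the set
  -- is finite.
  dominating-irreducible : ∀ (p : Subset (size D)) → Acc _⊂_ p →
                           ¬ ¬ (∃[ q ] Irreducible (_∈ q) × Dominates (_∈ q) (_∈ p))
  dominating-irreducible p (acc rec) ¬∃ =
    ¬¬-excluded-middle {A = ∃[ v ] v ∈ p × Dominates ((_∈ p) ∖ v) (_∈ p)} λ where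
      (no ¬dom)           → ¬∃ (p , (λ v v∈p dom → ¬dom (v , v∈p , dom)) , λ k col ¬col → ¬col col)
      (yes (v , v∈p , dom)) → dominating-irreducible (p - v) (rec (x∈p⇒p-x⊂p v∈p))
        λ (q , irr , q-dom) → ¬∃ (q , irr , λ k col ¬col →
          q-dom k col λ col′ →
          dom k (colourable-⊆ (λ (m , ≢v) → x∈p∧x≢y⇒x∈p-y m ≢v) col′) ¬col)

-- Quasi-transitive oriented graphs

  Adjacent : Rel V 0ℓ
  Adjacent u v = u ⟶ v ⊎ v ⟶ u

  adjacent? : ∀ u v → Dec (Adjacent u v)
  adjacent? u v = (arc D u v Bool.≟ true) ⊎-dec (arc D v u Bool.≟ true)

  -- Connectedness in the complement of the underlying graph, generated one vertex at a time so that
  -- induction can delete the last vertex added.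
  data CoConnected : Subset (size D) → Set where
    point  : ∀ x → CoConnected ⁅ x ⁆
    extend : ∀ {p x y} → CoConnected p → x ∉ p → y ∈ p → ¬ Adjacent x y → CoConnected (p ∪ ⁅ x ⁆)

  irreflexive : ∀ {u v} → u ⟶ v → u ≢ v
  irreflexive {u} a refl = contradiction (trans (sym a) (loopless D u)) λ ()

  module QuasiTransitive (oriented : Oriented D)
                         (quasi-transitive : ∀ {u v w} → u ⟶ v → v ⟶ w → Adjacent u w) where

    module _ {X : Pred V 0ℓ} where

      -- For the first arc `p → r` of the walk, `a` and `r` are adjacent: `a → r` shortens the walk,
      -- while `r → a` prolongs the return walk from `y` through `p` and `r` to `a`.
      cut-corner : ∀ {a p y} → Step X a p → Reach X p y → Reach X y p → a ⟶ y ⊎ Reach X y a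
      cut-corner (a , _) ε _ = inj₁ a
      cut-corner s@(a , xa , xp) (r@(b , _ , xr) ◅ rs) yp with quasi-transitive a b
      ... | inj₁ a⟶r = cut-corner (a⟶r , xa , xr) rs (yp ◅◅ r ◅ ε)
      ... | inj₂ r⟶a = inj₂ (yp ◅◅ r ◅ (r⟶a , xr , xa) ◅ ε)

      -- Induction on the walk, by the alternative holding for its second vertex `p`: if `y` reaches
      -- `p`, `cut-corner` applies; if `p → y`, the ends of `a → p → y` are adjacent.
      reach-trichotomy : ∀ {a y} → Reach X a y → a ≡ y ⊎ a ⟶ y ⊎ Reach X y a
      reach-trichotomy ε = inj₁ refl
      reach-trichotomy (s ◅ rs) with reach-trichotomy rs
      ... | inj₁ refl       = inj₂ (inj₁ (proj₁ s))
      ... | inj₂ (inj₂ yp)  = inj₂ (cut-corner s rs yp)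
      ... | inj₂ (inj₁ p⟶y) with quasi-transitive (proj₁ s) p⟶y
      ...   | inj₁ a⟶y = inj₂ (inj₁ a⟶y)
      ...   | inj₂ y⟶a = inj₂ (inj₂ ((y⟶a , target s rs , proj₁ (proj₂ s)) ◅ ε))
        where
        target : ∀ {a p y} → Step X a p → Reach X p y → X y
        target (_ , _ , xp) ε        = xp
        target _            (r ◅ rs) = target r rs

    -- X⁺ = X ∪ {x} is strong and y ∈ X is not adjacent to x. If u reaches y within X, then the
    -- first vertex a of X after x on a walk to u also reaches y; an arc a ⟶ y would make x and
    -- y adjacent, so y reaches a by trichotomy, hence u. The walk to x is treated dually.
    module Delete {X X⁺ : Pred V 0ℓ} {x y : V} (X⊆X⁺ : X ⊆ X⁺) (x∈X⁺ : X⁺ x)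
                  (split : ∀ {w} → X⁺ w → X w ⊎ w ≡ x) (x∉X : ¬ X x)
                  (xy : X y) (nonadjacent : ¬ Adjacent x y) (strong : Strong X⁺) where

      -- The walk is examined from its end, so the first departure from `x` that is met is the last
      -- one, and what follows it lies in `X`.
      last-exit : ∀ {s u} → X⁺ s → X u → Reach X⁺ s u →
                  (X s × Reach X s u) ⊎ (∃[ a ] x ⟶ a × X a × Reach X a u)
      last-exit _ xu ε = inj₁ (xu , ε)
      last-exit s∈ xu ((a , _ , t∈) ◅ rs) with last-exit t∈ xu rs | split s∈
      ... | inj₂ exit      | _         = inj₂ exit
      ... | inj₁ (xt , tu) | inj₁ xs   = inj₁ (xs , (a , xs , xt) ◅ tu)
      ... | inj₁ (xt , tu) | inj₂ refl = inj₂ (_ , a , xt , tu)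

      exit : ∀ {u} → X u → ∃[ a ] x ⟶ a × X a × Reach X a u
      exit xu with last-exit x∈X⁺ xu (strong x∈X⁺ (X⊆X⁺ xu))
      ... | inj₁ (xx , _) = contradiction xx x∉X
      ... | inj₂ e        = e

      first-entry : ∀ {u t} → X u → t ≡ x → Reach X⁺ u t → ∃[ b ] b ⟶ x × X b × Reach X u b
      first-entry xu eq ε = contradiction (transport X eq xu) x∉X
      first-entry xu eq ((a , _ , t∈) ◅ rs) with split t∈
      ... | inj₂ refl = _ , a , xu , ε
      ... | inj₁ xt   = let b , b⟶x , xb , tb = first-entry xt eq rs in
                        b , b⟶x , xb , (a , xu , xt) ◅ tb

      entry : ∀ {u} → X u → ∃[ b ] b ⟶ x × X b × Reach X u b
      entry xu = first-entry xu refl (strong (X⊆X⁺ xu) x∈X⁺)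

      from-y : ∀ {u} → X u → Reach X u y → Reach X y u
      from-y xu uy with a , x⟶a , xa , au ← exit xu with reach-trichotomy (au ◅◅ uy)
      ... | inj₁ refl       = contradiction (inj₁ x⟶a) nonadjacent
      ... | inj₂ (inj₁ a⟶y) = contradiction (quasi-transitive x⟶a a⟶y) nonadjacent
      ... | inj₂ (inj₂ ya)  = ya ◅◅ au

      to-y : ∀ {u} → X u → Reach X y u → Reach X u y
      to-y xu yu with b , b⟶x , xb , ub ← entry xu with reach-trichotomy (yu ◅◅ ub)
      ... | inj₁ refl       = contradiction (inj₂ b⟶x) nonadjacent
      ... | inj₂ (inj₁ y⟶b) = contradiction (swap (quasi-transitive y⟶b b⟶x)) nonadjacent
      ... | inj₂ (inj₂ by)  = ub ◅◅ by

      -- `y` reaches an in-neighbour `b` of `x`, and an out-neighbour `a` of `x` reaches `u`; the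
      -- ends of `b → x → a` are adjacent. If `a → b`, then `a` reaches `y` through `b` by `to-y`,
      -- and `from-y` reverses this.
      y-reaches : ∀ {u} → X u → Reach X y u
      y-reaches xu
        with b , b⟶x , xb , yb ← entry xy
        with a , x⟶a , xa , au ← exit xu
        with quasi-transitive b⟶x x⟶a
      ... | inj₁ b⟶a = yb ◅◅ (b⟶a , xb , xa) ◅ au
      ... | inj₂ a⟶b = from-y xa ((a⟶b , xa , xb) ◅ to-y xb yb) ◅◅ au

      strong⁻ : Strong X
      strong⁻ xu xv = to-y xu (y-reaches xu) ◅◅ y-reaches xv

      not-singleton : ¬ (∀ {u} → X u → u ≡ y)
      not-singleton only with a , x⟶a , xa , _ ← exit xy with only xa
      ... | refl = nonadjacent (inj₁ x⟶a)

    -- Deleting the last vertex added leaves a strong set, by induction the single vertex `y`. But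
    -- `x` has an out-neighbour in that set, and it is not adjacent to `y`.
    coConnected-strong : ∀ {p} → CoConnected p → Strong (_∈ p) → ∀ {u v} → u ∈ p → v ∈ p → u ≡ v
    coConnected-strong (point x) _ u∈ v∈ = trans (x∈⁅y⁆⇒x≡y x u∈) (sym (x∈⁅y⁆⇒x≡y x v∈))
    coConnected-strong (extend {p} {x} co x∉p y∈p nonadj) strong =
      ⊥-elim (not-singleton λ u∈ → coConnected-strong co strong⁻ u∈ y∈p)
      where open Delete {X = _∈ p} (λ m → x∈p∪q⁺ (inj₁ m)) (x∈p∪q⁺ (inj₂ (x∈⁅x⁆ x)))
                        (λ m → Sum.map₂ (x∈⁅y⁆⇒x≡y x) (x∈p∪q⁻ p ⁅ x ⁆ m)) x∉p y∈p nonadj strong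

    -- With `x → z → y`, or the reverse, `x` and `y` would be adjacent. So the direction of the arcs
    -- at `z` spreads along non-adjacent pairs.
    uniform : ∀ {p z} → CoConnected p → (∀ {m} → m ∈ p → Adjacent z m) →
              (∀ {m} → m ∈ p → z ⟶ m) ⊎ (∀ {m} → m ∈ p → m ⟶ z)
    uniform {z = z} (point x) adj with adj (x∈⁅x⁆ x)
    ... | inj₁ z⟶x = inj₁ λ m∈ → transport (z ⟶_) (sym (x∈⁅y⁆⇒x≡y x m∈)) z⟶x
    ... | inj₂ x⟶z = inj₂ λ m∈ → transport (_⟶ z) (sym (x∈⁅y⁆⇒x≡y x m∈)) x⟶z
    uniform {z = z} (extend {p} {x} co x∉p y∈p nonadj) adj
      with uniform co (λ m∈ → adj (x∈p∪q⁺ (inj₁ m∈))) | adj (x∈p∪q⁺ (inj₂ (x∈⁅x⁆ x)))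
    ... | inj₁ out | inj₂ x⟶z = contradiction (quasi-transitive x⟶z (out y∈p)) nonadj
    ... | inj₂ inn | inj₁ z⟶x = contradiction (swap (quasi-transitive (inn y∈p) z⟶x)) nonadj
    ... | inj₁ out | inj₁ z⟶x = inj₁ λ m∈ →
      [ out , (λ m∈x → transport (z ⟶_) (sym (x∈⁅y⁆⇒x≡y x m∈x)) z⟶x) ]′ (x∈p∪q⁻ p ⁅ x ⁆ m∈)
    ... | inj₂ inn | inj₂ x⟶z = inj₂ λ m∈ →
      [ inn , (λ m∈x → transport (_⟶ z) (sym (x∈⁅y⁆⇒x≡y x m∈x)) x⟶z) ]′ (x∈p∪q⁻ p ⁅ x ⁆ m∈)

    homogeneous : ∀ {S p} → CoConnected p →
                  (∀ {z m} → S z → z ∉ p → m ∈ p → Adjacent z m) → Homogeneous S (_∈ p)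
    homogeneous co adj {z} {m} {m′} sz z∉p m∈ m′∈ with uniform co (adj sz z∉p)
    ... | inj₁ out = trans (out m∈) (sym (out m′∈)) ,
                     trans (oriented z m (out m∈)) (sym (oriented z m′ (out m′∈)))
    ... | inj₂ inn = trans (oriented m z (inn m∈)) (sym (oriented m′ z (inn m′∈))) ,
                     trans (inn m∈) (sym (inn m′∈))

    -- Adding vertices of `S` non-adjacent to some member ends, by finiteness, in a component of the
    -- complement graph of `S`.
    coComponent : ∀ {S : Pred V 0ℓ} p → Acc _⊃_ p → CoConnected p → (_∈ p) ⊆ S →
                  ¬ ¬ (∃[ q ] CoConnected q × (_∈ p) ⊆ (_∈ q) × (_∈ q) ⊆ S ×
                       (∀ {z m} → S z → z ∉ q → m ∈ q → Adjacent z m))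
    coComponent {S} p (acc rec) co p⊆S ¬∃ =
      ¬¬-excluded-middle {A = ∃[ z ] ∃[ m ] S z × z ∉ p × m ∈ p × ¬ Adjacent z m} λ where
        (no ¬ext) → ¬∃ (p , co , id , p⊆S , λ {z} {m} sz z∉p m∈p →
          decidable-stable (adjacent? z m) λ nonadj → ¬ext (z , m , sz , z∉p , m∈p , nonadj))
        (yes (z , m , sz , z∉p , m∈p , nonadj)) →
          let p⊆p′ : (_∈ p) ⊆ (_∈ (p ∪ ⁅ z ⁆))
              p⊆p′ = λ m → x∈p∪q⁺ (inj₁ m)
          in coComponent (p ∪ ⁅ z ⁆)
               (rec ((λ m → p⊆p′ m) , z , x∈p∪q⁺ (inj₂ (x∈⁅x⁆ z)) , z∉p))
               (extend co z∉p m∈p nonadj)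
               (λ w∈ → [ p⊆S , (λ w∈z → transport S (sym (x∈⁅y⁆⇒x≡y z w∈z)) sz) ]′ (x∈p∪q⁻ p ⁅ z ⁆ w∈))
               λ (q , co′ , p′⊆q , rest) → ¬∃ (q , co′ , (λ m → p′⊆q (p⊆p′ m)) , rest)

    irreducible-adjacent : ∀ {S x y} → Irreducible S → S x → S y → x ≢ y → Adjacent x y
    irreducible-adjacent {S} {x} {y} irr sx sy x≢y =
      decidable-stable (adjacent? x y) λ nonadj →
      coComponent ⁅ x ⁆ (⊃-wellFounded _) (point x) (λ m → transport S (sym (x∈⁅y⁆⇒x≡y x m)) sx)
      λ (q , co , x⊆q , q⊆S , adj) →
      let x∈q = x⊆q (x∈⁅x⁆ x)
          -- Vertices of `S` outside the component `q` are adjacent to `x`, and `y` is not.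
          y∈q = decidable-stable (y ∈? q) λ y∉q → nonadj (swap (adj sy y∉q x∈q))
      in irreducible-strong (irreducible-homogeneous irr q⊆S (homogeneous co adj))
         λ strong → x≢y (coConnected-strong co strong x∈q y∈q)

    irreducible-tournament : ∀ S → Irreducible S → TournamentOn S
    irreducible-tournament S irr u v su sv u≢v with irreducible-adjacent irr su sv u≢v
    ... | inj₁ u⟶v = trans u⟶v (cong not (sym (oriented u v u⟶v)))
    ... | inj₂ v⟶u = trans (oriented v u v⟶u) (cong not (sym v⟶u))

oriented-P3-free-quasi-transitive : ∀ D → OrientedP3Free D →
  ∀ {u v w} → _⟶_ D u v → _⟶_ D v w → Adjacent D u w
oriented-P3-free-quasi-transitive D (oriented , P3-free) {u} {v} {w} uv vw =
  decidable-stable (adjacent? D u w) λ nonadj → P3-free (f , injective nonadj , arcs nonadj)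
  where
  f : Fin 3 → V D
  f zero             = u
  f (suc zero)       = v
  f (suc (suc zero)) = w

  u≢w : ¬ Adjacent D u w → u ≢ w
  u≢w nonadj refl = contradiction (trans (sym vw) (oriented u v uv)) λ ()

  injective : ¬ Adjacent D u w → Injective _≡_ _≡_ f
  injective na {zero}           {zero}           _ = refl
  injective na {zero}           {suc zero}       e = contradiction e (irreflexive D uv)
  injective na {zero}           {suc (suc zero)} e = contradiction e (u≢w na)
  injective na {suc zero}       {zero}           e = contradiction (sym e) (irreflexive D uv)
  injective na {suc zero}       {suc zero}       _ = refl
  injective na {suc zero}       {suc (suc zero)} e = contradiction e (irreflexive D vw)
  injective na {suc (suc zero)} {zero}           e = contradiction (sym e) (u≢w na)
  injective na {suc (suc zero)} {suc zero}       e = contradiction (sym e) (irreflexive D vw)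
  injective na {suc (suc zero)} {suc (suc zero)} _ = refl

  arcs : ¬ Adjacent D u w → ∀ i j → P3arc i j ≡ arc D (f i) (f j)
  arcs na zero             zero             = sym (loopless D u)
  arcs na zero             (suc zero)       = sym uv
  arcs na zero             (suc (suc zero)) = sym (Bool.¬-not (na ∘ inj₁))
  arcs na (suc zero)       zero             = sym (oriented u v uv)
  arcs na (suc zero)       (suc zero)       = sym (loopless D v)
  arcs na (suc zero)       (suc (suc zero)) = sym vw
  arcs na (suc (suc zero)) zero             = sym (Bool.¬-not (na ∘ inj₂))
  arcs na (suc (suc zero)) (suc zero)       = sym (oriented v w vw)
  arcs na (suc (suc zero)) (suc (suc zero)) = sym (loopless D w)

-- Blow-ups of digraphs in (𝒜 ∪ 𝒯)*

-- `D` on `S` arises from `G` by substituting a tournament, possibly empty, for each vertex; `f`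
-- tells which vertex was replaced.
record TournamentBlowUp (D G : Digraph) (S : Pred (V D) 0ℓ) (f : V D → V G) : Set where
  field
    between : ∀ {x y} → S x → S y → f x ≢ f y → arc D x y ≡ arc G (f x) (f y)
    within  : ∀ {x y} → S x → S y → f x ≡ f y → x ≢ y → arc D x y ≡ not (arc D y x)

module Substitution {D : Digraph} {n m}
                    (G : Fin (suc n) → Fin (suc n) → Bool) (lG : ∀ i → G i i ≡ false)
                    (u : Fin (suc n)) (H : Fin m → Fin m → Bool) (lH : ∀ i → H i i ≡ false)
                    {S : Pred (V D) 0ℓ} (irr : Irreducible D S) {f : V D → Fin (n + m)}
                    (blowUp : TournamentBlowUp D
                                (substitute (mkDigraph (suc n) G lG) u (mkDigraph m H lH)) S f)
                    where
  open TournamentBlowUp blowUp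

  merge : Fin n ⊎ Fin m → Fin (suc n)
  merge (inj₁ a) = punchIn u a
  merge (inj₂ _) = u

  side : V D → Fin n ⊎ Fin m
  side x = splitAt n (f x)

  side-injective : ∀ {x y} → side x ≡ side y → f x ≡ f y
  side-injective {x} {y} eq =
    trans (sym (Fin.join-splitAt n m (f x))) (trans (cong (join n m) eq) (Fin.join-splitAt n m (f y)))

  arc-side : ∀ {x y s t} → S x → S y → side x ≡ s → side y ≡ t → s ≢ t →
             arc D x y ≡ substArc′ G u H s t
  arc-side sx sy refl refl s≢t = between sx sy (s≢t ∘ cong (splitAt n))

  M : Pred (V D) 0ℓ
  M x = S x × ∃[ h ] side x ≡ inj₂ h

  M-homogeneous : Homogeneous D S M
  M-homogeneous {z} sz ¬mz (sm , h , eq) (sm′ , h′ , eq′) with side z in eqz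
  ... | inj₂ k = contradiction (sz , k , refl) ¬mz
  ... | inj₁ a =
    trans (arc-side sz sm eqz eq λ ()) (sym (arc-side sz sm′ eqz eq′ λ ())) ,
    trans (arc-side sm sz eq eqz λ ()) (sym (arc-side sm′ sz eq′ eqz λ ()))

  H′ : Digraph
  H′ = mkDigraph m H lH

  -- Arcs within one fibre have no image in `H`, so the projected walk drops them.
  project : ∀ {x y h h′} → side x ≡ inj₂ h → side y ≡ inj₂ h′ → Reach D M x y →
            Reach H′ (λ _ → ⊤) h h′
  project eq eq′ ε with refl ← trans (sym eq) eq′ = ε
  project {h = h} eq eq′ ((a , (sx , _) , (st , k , eqt)) ◅ rs) with h Fin.≟ k
  ... | yes refl = project eqt eq′ rs
  ... | no h≢k   =
    (trans (sym (arc-side sx st eq eqt (h≢k ∘ Sum.inj₂-injective))) a , tt , tt) ◅ project eqt eq′ rs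

  -- `M` is irreducible, hence strong, so two distinct vertices of `H` with non-empty fibres would
  -- lie on a closed walk in `H`.
  acyclic-fibre : Acyclic H′ → ∀ {x y h h′} → S x → S y → side x ≡ inj₂ h → side y ≡ inj₂ h′ →
                  h ≡ h′
  acyclic-fibre acyc {h = h} {h′} sx sy eq eq′ = decidable-stable (h Fin.≟ h′) λ h≢h′ →
    irreducible-strong D (irreducible-homogeneous D irr proj₁ M-homogeneous) λ strong →
    no-return h≢h′ (project eq eq′ (strong (sx , h , eq) (sy , h′ , eq′)))
                   (project eq′ eq (strong (sy , h′ , eq′) (sx , h , eq)))
    where
    no-return : ∀ {a b} → a ≢ b → Reach H′ (λ _ → ⊤) a b → ¬ Reach H′ (λ _ → ⊤) b a
    no-return a≢b ε        _  = a≢b refl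
    no-return a≢b (r ◅ rs) ba = noCycle H′ acyc r (rs ◅◅ ba)

  -- Merging `H` back into `u` undoes the substitution. The new fibre over `u` is still a
  -- tournament: for acyclic `H` it is at most one old fibre, and for a tournament `H` it is a
  -- tournament with tournaments substituted.
  merged : Acyclic H′ ⊎ Tournament H′ →
           TournamentBlowUp D (mkDigraph (suc n) G lG) S (merge ∘ side)
  merged kind = record { between = λ sx sy → between′ sx sy refl refl
                       ; within = λ sx sy → within′ sx sy refl refl }
    where
    between′ : ∀ {x y s t} → S x → S y → side x ≡ s → side y ≡ t → merge s ≢ merge t →
               arc D x y ≡ G (merge s) (merge t)
    between′ {s = s} {t} sx sy eq eq′ s≢t =
      trans (arc-side sx sy eq eq′ (s≢t ∘ cong merge)) (arc-merge s t s≢t)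
      where
      arc-merge : ∀ s t → merge s ≢ merge t → substArc′ G u H s t ≡ G (merge s) (merge t)
      arc-merge (inj₁ _) (inj₁ _) _ = refl
      arc-merge (inj₁ _) (inj₂ _) _ = refl
      arc-merge (inj₂ _) (inj₁ _) _ = refl
      arc-merge (inj₂ _) (inj₂ _) u≢u = contradiction refl u≢u

    within′ : ∀ {x y s t} → S x → S y → side x ≡ s → side y ≡ t → merge s ≡ merge t → x ≢ y →
              arc D x y ≡ not (arc D y x)
    within′ {s = inj₁ a} {inj₁ b} sx sy eq eq′ e =
      within sx sy (side-injective
        (trans eq (trans (cong inj₁ (Fin.punchIn-injective u a b e)) (sym eq′))))
    within′ {s = inj₁ a} {inj₂ _} _ _ _ _ e = contradiction e (Fin.punchInᵢ≢i u a)
    within′ {s = inj₂ _} {inj₁ b} _ _ _ _ e = contradiction (sym e) (Fin.punchInᵢ≢i u b)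
    within′ {s = inj₂ h} {inj₂ k} sx sy eq eq′ _ with h Fin.≟ k
    ... | yes refl = within sx sy (side-injective (trans eq (sym eq′)))
    ... | no h≢k   = λ _ → semicomplete kind
      where
      semicomplete : Acyclic H′ ⊎ Tournament H′ → arc D _ _ ≡ not (arc D _ _)
      semicomplete (inj₁ acyc) = contradiction (acyclic-fibre acyc sx sy eq eq′) h≢k
      semicomplete (inj₂ tour) =
        trans (arc-side sx sy eq eq′ (h≢k ∘ Sum.inj₂-injective))
        (trans (tour h k h≢k)
               (cong not (sym (arc-side sy sx eq′ eq (h≢k ∘ sym ∘ Sum.inj₂-injective)))))

-- Substitutions are undone one by one until `G` is a single vertex, whose fibre is all of `S`.
ATStar-blowUp : ∀ {D G S f} → ATStar G → Irreducible D S → TournamentBlowUp D G S f → TournamentOn D S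
ATStar-blowUp {f = f} single _ blowUp x y sx sy =
  TournamentBlowUp.within blowUp sx sy (unique (f x) (f y))
  where
  unique : ∀ (i j : Fin 1) → i ≡ j
  unique zero zero = refl
ATStar-blowUp (subst (mkDigraph (suc n) G lG) u (mkDigraph m H lH) at kind _) irr blowUp =
  ATStar-blowUp at irr (Substitution.merged G lG u H lH irr blowUp kind)

ATStar-irreducible-tournament : ∀ D → ATStar D → ∀ S → Irreducible D S → TournamentOn D S
ATStar-irreducible-tournament D at S irr = ATStar-blowUp {D} {D} {S} {id} at irr record
  { between = λ _ _ _ → refl
  ; within  = λ _ _ x≡y x≢y → contradiction x≡y x≢y }

-- Decidability of the dichromatic number

-- Functions are searched through their finite codes. Decoding gives a function back only pointwise,
-- hence the second hypothesis.
∃-function? : ∀ {m n} {P : (Fin m → Fin n) → Set} → (∀ f → Dec (P f)) →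
              (∀ {f g} → f ≗ g → P f → P g) → Dec (∃ P)
∃-function? P? resp = map′
  (λ (i , p) → finToFun i , p)
  (λ (f , p) → funToFin f , resp (sym ∘ Fin.finToFun-funToFin f) p)
  (Fin.any? (P? ∘ finToFun))

module _ (D : Digraph) where

  IsCycle : Pred (V D) 0ℓ → ∀ len → (Fin (suc len) → V D) → Set
  IsCycle P len g = (∀ i j → g i ≡ g j → i ≡ j) × (∀ i → arc D (g (inject₁ i)) (g (suc i)) ≡ true)
                    × arc D (g (fromℕ len)) (g zero) ≡ true × (∀ i → P (g i))

  isCycle? : ∀ {P} → Decidable P → ∀ len g → Dec (IsCycle P len g)
  isCycle? P? len g =
    Fin.all? (λ i → Fin.all? λ j → (g i Fin.≟ g j) →-dec (i Fin.≟ j))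
    ×-dec Fin.all? (λ i → arc D (g (inject₁ i)) (g (suc i)) Bool.≟ true)
    ×-dec (arc D (g (fromℕ len)) (g zero) Bool.≟ true)
    ×-dec Fin.all? (P? ∘ g)

  isCycle-≗ : ∀ {P len g g′} → g ≗ g′ → IsCycle P len g → IsCycle P len g′
  isCycle-≗ {P} g≗g′ (inj , step , close , inside) =
    (λ i j e → inj i j (trans (g≗g′ i) (trans e (sym (g≗g′ j))))) ,
    (λ i → trans (sym (cong₂ (arc D) (g≗g′ (inject₁ i)) (g≗g′ (suc i)))) (step i)) ,
    trans (sym (cong₂ (arc D) (g≗g′ (fromℕ _)) (g≗g′ zero))) close ,
    (λ i → transport P (g≗g′ i) (inside i))

  cycle? : ∀ {P} → Decidable P → Dec (Cycle D P)
  cycle? {P} P? = map′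
    (λ (_ , g , inj , step , close , inside) → record
      { g = g ; inj = inj _ _ ; step = step ; close = close ; inside = inside })
    -- Injectivity gives `suc len ≤ size D`, so searching the lengths below `size D` suffices.
    (λ cyc → let open Cycle cyc ; len< = Fin.injective⇒≤ inj in
      fromℕ< len< , transport (∃ ∘ IsCycle P) (sym (Fin.toℕ-fromℕ< len<))
        (g , (λ _ _ → inj) , step , close , inside))
    (Fin.any? λ i → ∃-function? (isCycle? P? (toℕ i)) (isCycle-≗ {P}))

  dichromaticAtMost? : ∀ k → Dec (DichromaticAtMost D k)
  dichromaticAtMost? k = ∃-function?
    (λ c → Fin.all? λ col → ¬? (cycle? λ v → c v Fin.≟ col))
    (λ c≗c′ ¬cyc col cyc → let open Cycle cyc in ¬cyc col record
      { g = g ; inj = inj ; step = step ; close = close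
      ; inside = λ i → trans (c≗c′ (g i)) (inside i) })

  dichromatic : ∀ {k} → Colourable D (_∈ full) k → DichromaticAtMost D k
  dichromatic (c , c<k , acyc) = (λ v → fromℕ< (c<k v ∈⊤)) , λ col cyc →
    cycle⇒closed-walk D cyc (NoCycle-⊆ (λ (a , eu , ev) →
      (a , ∈⊤ , ∈⊤) , Fin.fromℕ<-injective _ _ _ _ (trans eu (sym ev))) acyc)

  -- Induced subdigraphs

  module Induced (p : Subset (size D)) where

    vertices : List (V D)
    vertices = filter (_∈? p) (allFin (size D))

    induced : Digraph
    induced = mkDigraph (length vertices) (λ i j → arc D (lookup vertices i) (lookup vertices j))
                        (λ i → loopless D (lookup vertices i))

    vertices-injective : ∀ {i j} → lookup vertices i ≡ lookup vertices j → i ≡ j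
    vertices-injective = lookup-injective (Unique.filter⁺ (_∈? p) (Unique.allFin⁺ (size D))) _ _

    induced-embeds : Embeds induced D
    induced-embeds = lookup vertices , vertices-injective , λ _ _ → refl

    induced-tournament : TournamentOn D (_∈ p) → Tournament induced
    induced-tournament tour i j i≢j = tour _ _ (∈p i) (∈p j) (i≢j ∘ vertices-injective)
      where
      ∈p : ∀ i → lookup vertices i ∈ p
      ∈p i = proj₂ (∈-filter⁻ (_∈? p) {xs = allFin (size D)} (∈-lookup i))

    module _ {k} (c : Fin (length vertices) → Fin k) where

      position : ∀ {w} → w ∈ p → ∃[ i ] lookup vertices i ≡ w
      position {w} w∈ = index w∈vs , sym (lookup-index w∈vs)
        where
        w∈vs : w List.∈ vertices
        w∈vs = ∈-filter⁺ (_∈? p) (∈-allFin w) w∈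

      colour : V D → ℕ
      colour w with w ∈? p
      ... | yes w∈ = toℕ (c (proj₁ (position w∈)))
      ... | no _   = 0

      colour-position : ∀ {w i} → w ∈ p → lookup vertices i ≡ w → colour w ≡ toℕ (c i)
      colour-position {w} w∈ eq with w ∈? p
      ... | yes w∈′ = cong (toℕ ∘ c) (vertices-injective (trans (proj₂ (position w∈′)) (sym eq)))
      ... | no w∉   = contradiction w∈ w∉

      step-induced : ∀ {u v i} → lookup vertices i ≡ u → Mono D (_∈ p) colour u v →
                     ∃[ j ] lookup vertices j ≡ v × c i ≡ c j ×
                     Step induced (λ w → c w ≡ c i) i j
      step-induced refl ((a , u∈ , v∈) , eq) with j , refl ← position v∈ =
        let ci≡cj = Fin.toℕ-injective (trans (sym (colour-position u∈ refl))
                                             (trans eq (colour-position v∈ refl)))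
        in j , refl , ci≡cj , a , refl , sym ci≡cj

      walk-induced : ∀ {u v i} → lookup vertices i ≡ u → Star (Mono D (_∈ p) colour) u v →
                     ∃[ j ] lookup vertices j ≡ v × Reach induced (λ w → c w ≡ c i) i j
      walk-induced eq ε = _ , eq , ε
      walk-induced eq (r ◅ rs) with j , eqj , ci≡cj , r′ ← step-induced eq r
        with l , eql , rs′ ← walk-induced eqj rs =
        l , eql , r′ ◅ transport (λ col → Reach induced (λ w → c w ≡ col) j l) (sym ci≡cj) rs′

    colourable-induced : ∀ {k} → DichromaticAtMost induced k → Colourable D (_∈ p) k
    colourable-induced {k} (c , ¬cyc) = colour c , bound , acyclic
      where
      bound : ∀ w → w ∈ p → colour c w < k
      bound w w∈ = let i , eq = position c w∈ in
        transport (_< k) (sym (colour-position c w∈ eq)) (Fin.toℕ<n (c i))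
      acyclic : NoCycle (Mono D (_∈ p) (colour c))
      acyclic r@((_ , u∈ , _) , _) rs
        with i , eq ← position c u∈
        with j , eqj , ci≡cj , r′ ← step-induced c eq r
        with l , eql , rs′ ← walk-induced c eqj rs
        with refl ← vertices-injective (trans eql (sym eq)) =
        noCycle induced (¬cyc (c i)) r′
          (transport (λ col → Reach induced (λ w → c w ≡ col) j i) (sym ci≡cj) rs′)

-- Transfer of heroes between classes

embeds-trans : ∀ {H T D} → Embeds H T → Embeds T D → Embeds H D
embeds-trans (f , f-inj , f-arc) (g , g-inj , g-arc) =
  g ∘ f , f-inj ∘ g-inj , λ i j → trans (f-arc i j) (g-arc (f i) (f j))

-- An irreducible dominating set induces an `H`-free tournament, so the constant for tournaments
-- serves for `C` as well.
hero-from-tournaments : ∀ {C : Digraph → Set} →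
  (∀ D → C D → ∀ S → Irreducible D S → TournamentOn D S) →
  ∀ H → Hero Tournament H → Hero C H
hero-from-tournaments tournament H (k , bound) = k , λ D D∈C H-free →
  decidable-stable (dichromaticAtMost? D k) λ ¬col →
  dominating-irreducible D full (⊂-wellFounded full) λ (q , irr , dom) →
  let open Induced D q in
  dom k (colourable-induced (bound induced (induced-tournament (tournament D D∈C (_∈ q) irr))
                                   (λ emb → H-free (embeds-trans {H} {induced} {D} emb induced-embeds))))
      (¬col ∘ dichromatic D)

hero-⊆ : ∀ {C C′ : Digraph → Set} → (∀ D → C D → C′ D) → ∀ H → Hero C′ H → Hero C H
hero-⊆ C⊆C′ H (k , bound) = k , λ D D∈C → bound D (C⊆C′ D D∈C)

hero-ATStar⇒hero-tournament : ∀ H → Hero ATStar H → Hero Tournament H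
hero-ATStar⇒hero-tournament H (k , bound) = k , λ where
  -- `ATStar` contains no empty digraph, so the empty tournament is coloured directly.
  (mkDigraph zero _ _)            _    _ → (λ ()) , λ _ cyc → contradiction (Cycle.g cyc zero) λ ()
  -- Substituting `D` for the only vertex yields `D` itself by computation.
  D@(mkDigraph (suc n) _ _) tour → bound D (subst SingleVertex zero D single (inj₂ tour) (n , refl))

tournament-oriented-P3-free : ∀ D → Tournament D → OrientedP3Free D
tournament-oriented-P3-free D tour = oriented , λ (f , f-inj , f-arc) →
  contradiction (trans (f-arc zero (suc (suc zero)))
    (trans (tour _ _ λ e → contradiction (f-inj e) λ ())
           (cong not (sym (f-arc (suc (suc zero)) zero))))) λ ()
  where
  oriented : Oriented D
  oriented i j a = trans (tour j i (irreflexive D a ∘ sym)) (cong not a)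

theorem6p2p1 : (∀ (H : Digraph) → Hero ATStar H ⇔ Hero Tournament H)
    × (∀ (H : Digraph) → Hero OrientedP3Free H ⇔ Hero Tournament H)
theorem6p2p1 =
  (λ H → mk⇔ (hero-ATStar⇒hero-tournament H)
             (hero-from-tournaments ATStar-irreducible-tournament H)) ,
  (λ H → mk⇔ (hero-⊆ tournament-oriented-P3-free H)
             (hero-from-tournaments (λ D free → QuasiTransitive.irreducible-tournament D
               (proj₁ free) (oriented-P3-free-quasi-transitive D free)) H))
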